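{- Let $c>0$. In the semi-oblivious cup game with additive error $c$ on $n$ cups, the adversary can force backlog $(c+1)\ln n-O(c+1)$ against the greedy algorithm; that is, there is an absolute constant $C$ such that for all $c>0$ and $n\ge 1$ there is an adversary strategy that makes the backlog of greedy at least $(c+1)\ln n-C(c+1)$.
   Context: Semi-oblivious cup game with additive error $c>0$. There are $n$ cups, initially empty; heights are nonnegative reals. Time proceeds in discrete steps. In each step the adversary first distributes $1$ unit of water among the cups arbitrarily (nonnegative amounts summing to $1$), resulting in intermediate heights $g_1(t),\dots,g_n(t)$. The adversary then shows the player estimates $g_i'(t)\in[g_i(t),\,g_i(t)+c]$ for each cup $i$, of the adversary's choice. The player then selects one cup and removes up to $1$ unit of water from it: if cup $i$ is selected, its height becomes $\max(g_i(t)-1,0)$, and all other heights are unchanged. The adversary may be adaptive. Greedy algorithm: the player always selects a cup $i$ with maximal estimate $g_i'(t)$, ties broken arbitrarily; for worst-case purposes ties may be assumed to be broken as the adversary prefers. Backlog: the supremum over all time steps (including the intermediate moment after the adversary's move) of the height of the fullest cup. -}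

module Defs where

open import Data.Nat as ℕ using (ℕ; zero; suc; pred; NonZero)
import Data.Nat.Properties as ℕ
open import Data.Integer as ℤ using (+_)
import Data.Integer.Properties as ℤ
open import Data.Rational as ℚ using
  (ℚ; mkℚ; 0ℚ; 1ℚ; _+_; _*_; -_; _-_; _⊔_; ∣_∣; _≤_; _<_; _/_; 1/_; ½; Positive;
   *≤*; *<*; nonNegative; positive; toℚᵘ)
open import Data.Rational.Properties
import Data.Rational.Unnormalised as ℚᵘ
import Data.Rational.Unnormalised.Properties as ℚᵘ
open import Data.Fin using (Fin)
open import Data.List using (List; []; _∷_)
open import Data.Vec.Functional using (Vector; foldr; updateAt)
open import Data.Product using (Σ-syntax; ∃; _×_; _,_)
open import Data.Sum using (inj₁; inj₂)
open import Relation.Binary.PropositionalEquality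
open import Data.Rational.Solver using (module +-*-Solver)

open +-*-Solver using (solve; con) renaming
  (_:+_ to _⊕_; _:*_ to _⊗_; :-_ to ⊝_; _:-_ to _⊖_; _:=_ to _⊜_)

private

  half+half : ∀ p → ½ * p + ½ * p ≡ p
  half+half p = trans (sym (*-distribʳ-+ p ½ ½)) (*-identityˡ p)

  *-pos : ∀ {p q} → 0ℚ < p → 0ℚ < q → 0ℚ < p * q
  *-pos {p} {q} 0<p 0<q = subst (_< p * q) (*-zeroʳ p)
    (*-monoʳ-<-pos p {{positive 0<p}} 0<q)

  *-monoˡ : ∀ {p q} r → 0ℚ ≤ r → p ≤ q → r * p ≤ r * q
  *-monoˡ r 0≤r = *-monoˡ-≤-nonNeg r {{nonNegative 0≤r}}

  *-monoʳ : ∀ {p q} r → 0ℚ ≤ r → p ≤ q → p * r ≤ q * r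
  *-monoʳ r 0≤r = *-monoʳ-≤-nonNeg r {{nonNegative 0≤r}}

  ≤-by-diff : ∀ {p q r} → p - q ≤ r → p ≤ q + r
  ≤-by-diff {p} {q} {r} d = subst (_≤ q + r)
    (solve 2 (λ p q → q ⊕ (p ⊖ q) ⊜ p) refl p q) (+-monoʳ-≤ q d)

  diff-≤ : ∀ {p q r} → p ≤ q + r → p - q ≤ r
  diff-≤ {p} {q} {r} d = subst (p - q ≤_)
    (solve 2 (λ q r → (q ⊕ r) ⊖ q ⊜ r) refl q r) (+-monoˡ-≤ (- q) d)

  p≤∣p∣ : ∀ p → p ≤ ∣ p ∣
  p≤∣p∣ p with ∣p∣≡p∨∣p∣≡-p p | ≤-total 0ℚ p
  ... | inj₁ e | _        = ≤-reflexive (sym e)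
  ... | inj₂ _ | inj₁ 0≤p = ≤-reflexive (sym (0≤p⇒∣p∣≡p 0≤p))
  ... | inj₂ _ | inj₂ p≤0 = ≤-trans p≤0 (0≤∣p∣ p)

  swap-diff : ∀ p q → - (p - q) ≡ q - p
  swap-diff = solve 2 (λ p q → ⊝ (p ⊖ q) ⊜ q ⊖ p) refl

  ∣∣-≤ : ∀ {p q r} → p ≤ q + r → q ≤ p + r → ∣ p - q ∣ ≤ r
  ∣∣-≤ {p} {q} {r} a b with ∣p∣≡p∨∣p∣≡-p (p - q)
  ... | inj₁ e = subst (_≤ r) (sym e) (diff-≤ a)
  ... | inj₂ e = subst (_≤ r) (sym (trans e (swap-diff p q))) (diff-≤ b)

  ∣∣-≤⇒ˡ : ∀ {p q r} → ∣ p - q ∣ ≤ r → p ≤ q + r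
  ∣∣-≤⇒ˡ d = ≤-by-diff (≤-trans (p≤∣p∣ _) d)

  ∣∣-≤⇒ʳ : ∀ {p q r} → ∣ p - q ∣ ≤ r → q ≤ p + r
  ∣∣-≤⇒ʳ {p} {q} {r} d = ∣∣-≤⇒ˡ (subst (_≤ r)
    (trans (sym (∣-p∣≡∣p∣ (p - q))) (cong ∣_∣ (swap-diff p q))) d)

  ∣p∣≤∣q∣+∣p-q∣ : ∀ p q → ∣ p ∣ ≤ ∣ q ∣ + ∣ p - q ∣
  ∣p∣≤∣q∣+∣p-q∣ p q = subst (λ x → ∣ x ∣ ≤ ∣ q ∣ + ∣ p - q ∣)
    (solve 2 (λ p q → q ⊕ (p ⊖ q) ⊜ p) refl p q) (∣p+q∣≤∣p∣+∣q∣ q (p - q))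

-- Reals are Cauchy sequences of rationals, to be compared by _≈ᴿ_, not _≡_.

IsCauchy : (ℕ → ℚ) → Set
IsCauchy x = ∀ ε → 0ℚ < ε →
  ∃ λ N → ∀ m n → N ℕ.≤ m → N ℕ.≤ n → ∣ x m - x n ∣ ≤ ε

record ℝ : Set where
  constructor mkℝ
  field
    seq    : ℕ → ℚ
    cauchy : IsCauchy seq

open ℝ public

infix  4 _≤ᴿ_ _<ᴿ_ _≈ᴿ_
infixl 6 _+ᴿ_ _-ᴿ_ _⊔ᴿ_
infixl 7 _*ᴿ_
infix  8 -ᴿ_

_≤ᴿ_ : ℝ → ℝ → Set
x ≤ᴿ y = ∀ ε → 0ℚ < ε → ∃ λ N → ∀ n → N ℕ.≤ n → seq x n ≤ seq y n + ε

_<ᴿ_ : ℝ → ℝ → Set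
x <ᴿ y = ∃ λ ε → 0ℚ < ε × ∃ λ N → ∀ n → N ℕ.≤ n → seq x n + ε ≤ seq y n

_≈ᴿ_ : ℝ → ℝ → Set
x ≈ᴿ y = ∀ ε → 0ℚ < ε → ∃ λ N → ∀ n → N ℕ.≤ n → ∣ seq x n - seq y n ∣ ≤ ε

private abstract

  const-cauchy : ∀ q → IsCauchy (λ _ → q)
  const-cauchy q ε 0<ε = 0 , λ _ _ _ _ →
    subst (_≤ ε) (sym (cong ∣_∣ (+-inverseʳ q))) (<⇒≤ 0<ε)

  neg-cauchy : ∀ x → IsCauchy (λ n → - seq x n)
  neg-cauchy x ε 0<ε = let N , f = cauchy x ε 0<ε in
    N , λ m n N≤m N≤n → subst (_≤ ε) (flip (seq x m) (seq x n)) (f m n N≤m N≤n)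
    where
    flip : ∀ p q → ∣ p - q ∣ ≡ ∣ - p - - q ∣
    flip p q = trans (sym (∣-p∣≡∣p∣ (p - q)))
      (cong ∣_∣ (solve 2 (λ p q → ⊝ (p ⊖ q) ⊜ ⊝ p ⊖ ⊝ q) refl p q))

fromℚ : ℚ → ℝ
fromℚ q = mkℝ (λ _ → q) (const-cauchy q)

0ℝ 1ℝ : ℝ
0ℝ = fromℚ 0ℚ
1ℝ = fromℚ 1ℚ

-ᴿ_ : ℝ → ℝ
-ᴿ x = mkℝ (λ n → - seq x n) (neg-cauchy x)

private abstract

  pointwise₂ : (f : ℚ → ℚ → ℚ) →
    (∀ p q r s → ∣ f p r - f q s ∣ ≤ ∣ p - q ∣ + ∣ r - s ∣) →
    ∀ x y → IsCauchy (λ n → f (seq x n) (seq y n))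
  pointwise₂ f lip x y ε 0<ε =
    let 0<½ε = *-pos {½} {ε} (*<* (ℤ.+<+ (ℕ.s≤s ℕ.z≤n))) 0<ε
        M , F = cauchy x (½ * ε) 0<½ε
        N , G = cauchy y (½ * ε) 0<½ε
    in M ℕ.⊔ N , λ m n a b → ≤-trans (lip _ _ _ _) (subst (_ ≤_) (half+half ε)
      (+-mono-≤ (F m n (ℕ.m⊔n≤o⇒m≤o M N a) (ℕ.m⊔n≤o⇒m≤o M N b))
                (G m n (ℕ.m⊔n≤o⇒n≤o M N a) (ℕ.m⊔n≤o⇒n≤o M N b))))

  +-lipschitz : ∀ p q r s → ∣ (p + r) - (q + s) ∣ ≤ ∣ p - q ∣ + ∣ r - s ∣
  +-lipschitz p q r s = subst (λ t → ∣ t ∣ ≤ ∣ p - q ∣ + ∣ r - s ∣)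
    (solve 4 (λ p q r s → (p ⊖ q) ⊕ (r ⊖ s) ⊜ (p ⊕ r) ⊖ (q ⊕ s)) refl p q r s)
    (∣p+q∣≤∣p∣+∣q∣ (p - q) (r - s))

  ⊔-lipschitz : ∀ p q r s → ∣ (p ⊔ r) - (q ⊔ s) ∣ ≤ ∣ p - q ∣ + ∣ r - s ∣
  ⊔-lipschitz p q r s = ∣∣-≤
    (⊔-bound p q r s (∣∣-≤⇒ˡ {p} {q} ≤-refl) (∣∣-≤⇒ˡ {r} {s} ≤-refl))
    (⊔-bound q p s r (∣∣-≤⇒ʳ {p} {q} ≤-refl) (∣∣-≤⇒ʳ {r} {s} ≤-refl))
    where
    d e : ℚ
    d = ∣ p - q ∣
    e = ∣ r - s ∣
    d≤ : d ≤ d + e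
    d≤ = subst (_≤ d + e) (+-identityʳ d) (+-monoʳ-≤ d (0≤∣p∣ (r - s)))
    e≤ : e ≤ d + e
    e≤ = subst (_≤ d + e) (+-identityˡ e) (+-monoˡ-≤ e (0≤∣p∣ (p - q)))
    ⊔-bound : ∀ a b t u → a ≤ b + d → t ≤ u + e → a ⊔ t ≤ (b ⊔ u) + (d + e)
    ⊔-bound a b t u h k = ⊔-lub {_} {a} {t}
      (≤-trans h (+-mono-≤ {b} {b ⊔ u} {d} {d + e} (p≤p⊔q b u) d≤))
      (≤-trans k (+-mono-≤ {u} {b ⊔ u} {e} {d + e} (p≤q⊔p b u) e≤))

  bounded : ∀ x → Σ[ B ∈ ℚ ] 0ℚ < B × ∃ λ N → ∀ n → N ℕ.≤ n → ∣ seq x n ∣ ≤ B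
  bounded x = let N , F = cauchy x 1ℚ 0<1 in
      ∣ seq x N ∣ + 1ℚ
    , <-≤-trans 0<1 (subst (_≤ ∣ seq x N ∣ + 1ℚ) (+-identityˡ 1ℚ)
        (+-monoˡ-≤ 1ℚ (0≤∣p∣ (seq x N))))
    , N , λ n N≤n → ≤-trans (∣p∣≤∣q∣+∣p-q∣ (seq x n) (seq x N))
        (+-monoʳ-≤ ∣ seq x N ∣ (F n N N≤n ℕ.≤-refl))
    where
    0<1 : 0ℚ < 1ℚ
    0<1 = *<* (ℤ.+<+ (ℕ.s≤s ℕ.z≤n))

  *-lipschitz : ∀ p q r s →
    ∣ p * r - q * s ∣ ≤ ∣ p ∣ * ∣ r - s ∣ + ∣ p - q ∣ * ∣ s ∣
  *-lipschitz p q r s = subst₂ _≤_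
    (cong ∣_∣ (solve 4 (λ p q r s →
      p ⊗ (r ⊖ s) ⊕ (p ⊖ q) ⊗ s ⊜ p ⊗ r ⊖ q ⊗ s) refl p q r s))
    (cong₂ _+_ (∣p*q∣≡∣p∣*∣q∣ p (r - s)) (∣p*q∣≡∣p∣*∣q∣ (p - q) s))
    (∣p+q∣≤∣p∣+∣q∣ (p * (r - s)) ((p - q) * s))

  *-cauchy : ∀ x y → IsCauchy (λ n → seq x n * seq y n)
  *-cauchy x y ε 0<ε =
    let A , 0<A , K , HA = bounded x
        B , 0<B , L , HB = bounded y
        0<S  = subst (_< A + B) (+-identityˡ 0ℚ) (+-mono-< 0<A 0<B)
        δ , 0<δ , Sδ = split (A + B) 0<S
        M , F = cauchy x δ 0<δ
        N , G = cauchy y δ 0<δ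
        T = (K ℕ.⊔ L) ℕ.⊔ (M ℕ.⊔ N)
    in T , λ m n a b →
      let a₁ = ℕ.m⊔n≤o⇒m≤o (K ℕ.⊔ L) (M ℕ.⊔ N) a
          a₂ = ℕ.m⊔n≤o⇒n≤o (K ℕ.⊔ L) (M ℕ.⊔ N) a
          b₁ = ℕ.m⊔n≤o⇒m≤o (K ℕ.⊔ L) (M ℕ.⊔ N) b
          b₂ = ℕ.m⊔n≤o⇒n≤o (K ℕ.⊔ L) (M ℕ.⊔ N) b
          dx = F m n (ℕ.m⊔n≤o⇒m≤o M N a₂) (ℕ.m⊔n≤o⇒m≤o M N b₂)
          dy = G m n (ℕ.m⊔n≤o⇒n≤o M N a₂) (ℕ.m⊔n≤o⇒n≤o M N b₂)
          bx = HA m (ℕ.m⊔n≤o⇒m≤o K L a₁)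
          by = HB n (ℕ.m⊔n≤o⇒n≤o K L b₁)
      in ≤-trans (*-lipschitz (seq x m) (seq x n) (seq y m) (seq y n))
        (subst (_ ≤_) (trans (solve 3 (λ A B δ → A ⊗ δ ⊕ δ ⊗ B ⊜ (A ⊕ B) ⊗ δ)
                         refl A B δ) Sδ)
          (+-mono-≤
            (≤-trans (*-monoʳ _ (0≤∣p∣ (seq y m - seq y n)) bx)
                     (*-monoˡ A (<⇒≤ 0<A) dy))
            (≤-trans (*-monoʳ _ (0≤∣p∣ (seq y n)) dx)
                     (*-monoˡ δ (<⇒≤ 0<δ) by))))
    where
    split : ∀ S → 0ℚ < S → Σ[ δ ∈ ℚ ] 0ℚ < δ × S * δ ≡ ε
    split S 0<S = 1/ S * ε
      , *-pos (positive⁻¹ (1/ S) {{1/pos⇒pos S}}) 0<ε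
      , trans (sym (*-assoc S (1/ S) ε))
          (trans (cong (_* ε) (*-inverseʳ S)) (*-identityˡ ε))
      where
      instance
        S-pos : Positive S
        S-pos = positive 0<S
        S-nonZero : ℚ.NonZero S
        S-nonZero = pos⇒nonZero S

_+ᴿ_ : ℝ → ℝ → ℝ
x +ᴿ y = mkℝ (λ n → seq x n + seq y n) (pointwise₂ _+_ +-lipschitz x y)

_-ᴿ_ : ℝ → ℝ → ℝ
x -ᴿ y = x +ᴿ (-ᴿ y)

_⊔ᴿ_ : ℝ → ℝ → ℝ
x ⊔ᴿ y = mkℝ (λ n → seq x n ⊔ seq y n) (pointwise₂ _⊔_ ⊔-lipschitz x y)

_*ᴿ_ : ℝ → ℝ → ℝ
x *ᴿ y = mkℝ (λ n → seq x n * seq y n) (*-cauchy x y)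

sumᴿ : ∀ {n} → Vector ℝ n → ℝ
sumᴿ = foldr _+ᴿ_ 0ℝ

-- B ≤sup S says that B is at most the supremum of S in ℝ ∪ {∞}.  It is
-- phrased without naming the supremum, which may be infinite.

_≤sup_ : ℝ → (ℝ → Set) → Set
B ≤sup S = ∀ ε → 0ℝ <ᴿ ε → ∃ λ x → S x × B -ᴿ ε <ᴿ x

∑ : ℕ → (ℕ → ℚ) → ℚ
∑ zero    f = 0ℚ
∑ (suc k) f = ∑ k f + f k

1/suc : ℕ → ℚ
1/suc k = + 1 / suc k

-- ln n = ∫₁ⁿ dx / x.  With m = k + 1, the right Riemann sum with mesh 1 / m is
--   Σ_{i = 1}^{(n - 1) m}  (1 / m) · 1 / (1 + i / m)
--     =  Σ_{i = 1}^{(n - 1) m}  1 / (m + i).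

lnSum : ℕ → ℕ → ℚ
lnSum n k = ∑ (pred n ℕ.* suc k) λ i → 1/suc (suc k ℕ.+ i)

private

  1/suc-anti : ∀ {a b} → a ℕ.≤ b → 1/suc b ≤ 1/suc a
  1/suc-anti {a} {b} a≤b = toℚᵘ-cancel-≤ (begin
    toℚᵘ (1/suc b)       ≃⟨ toℚᵘ-fromℚᵘ (ℚᵘ.mkℚᵘ (+ 1) b) ⟩
    ℚᵘ.mkℚᵘ (+ 1) b      ≤⟨ ℚᵘ.*≤* (ℤ.*-monoˡ-≤-nonNeg (+ 1) (ℤ.+≤+ (ℕ.s≤s a≤b))) ⟩
    ℚᵘ.mkℚᵘ (+ 1) a      ≃⟨ toℚᵘ-fromℚᵘ (ℚᵘ.mkℚᵘ (+ 1) a) ⟨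
    toℚᵘ (1/suc a)       ∎)
    where open ℚᵘ.≤-Reasoning

  1/suc-pos : ∀ k → 0ℚ ≤ 1/suc k
  1/suc-pos k = nonNegative⁻¹ (1/suc k) {{normalize-nonNeg 1 (suc k)}}

  archimedean : ∀ ε → 0ℚ < ε → ∃ λ k → 1/suc k ≤ ε
  archimedean ε@(mkℚ (+ suc p) d _) _ = d , toℚᵘ-cancel-≤ (begin
    toℚᵘ (1/suc d)       ≃⟨ toℚᵘ-fromℚᵘ (ℚᵘ.mkℚᵘ (+ 1) d) ⟩
    ℚᵘ.mkℚᵘ (+ 1) d      ≤⟨ ℚᵘ.*≤* (ℤ.*-monoʳ-≤-nonNeg (+ suc d) {+ 1} {+ suc p} (ℤ.+≤+ (ℕ.s≤s ℕ.z≤n))) ⟩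
    toℚᵘ ε               ∎)
    where open ℚᵘ.≤-Reasoning
  archimedean (mkℚ (+ 0) _ _)        (*<* (ℤ.+<+ ()))
  archimedean (mkℚ (ℤ.-[1+ _ ]) _ _) (*<* ())

  ∑-+ : ∀ a b f → ∑ (a ℕ.+ b) f ≡ ∑ a f + ∑ b (λ i → f (a ℕ.+ i))
  ∑-+ a zero f rewrite ℕ.+-identityʳ a = sym (+-identityʳ _)
  ∑-+ a (suc b) f rewrite ℕ.+-suc a b =
    trans (cong (_+ f (a ℕ.+ b)) (∑-+ a b f))
      (+-assoc (∑ a f) (∑ b λ i → f (a ℕ.+ i)) (f (a ℕ.+ b)))

  ι : ℕ → ℚ
  ι n = + n / 1

  ι-suc : ∀ n → ι (suc n) ≡ 1ℚ + ι n
  ι-suc n = toℚᵘ-injective (begin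
    toℚᵘ (ι (suc n))                      ≈⟨ toℚᵘ-fromℚᵘ (ℚᵘ.mkℚᵘ (+ suc n) 0) ⟩
    ℚᵘ.mkℚᵘ (+ suc n) 0                   ≈⟨ ℚᵘ.*≡* (cong (λ t → (+ 1 ℤ.+ t) ℤ.* + 1)
                                              (sym (ℤ.*-identityʳ (+ n)))) ⟩
    ℚᵘ.1ℚᵘ ℚᵘ.+ ℚᵘ.mkℚᵘ (+ n) 0           ≈⟨ ℚᵘ.+-congʳ ℚᵘ.1ℚᵘ (toℚᵘ-fromℚᵘ (ℚᵘ.mkℚᵘ (+ n) 0)) ⟨
    toℚᵘ 1ℚ ℚᵘ.+ toℚᵘ (ι n)               ≈⟨ toℚᵘ-homo-+ 1ℚ (ι n) ⟨
    toℚᵘ (1ℚ + ι n)                       ∎)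
    where open import Relation.Binary.Reasoning.Setoid ℚᵘ.≃-setoid

  ι-1/suc : ∀ n k m → suc k ≡ n ℕ.* suc m → ι n * 1/suc k ≡ 1/suc m
  ι-1/suc n k m e = toℚᵘ-injective (begin
    toℚᵘ (ι n * 1/suc k)                  ≈⟨ toℚᵘ-homo-* (ι n) (1/suc k) ⟩
    toℚᵘ (ι n) ℚᵘ.* toℚᵘ (1/suc k)        ≈⟨ ℚᵘ.*-cong (toℚᵘ-fromℚᵘ (ℚᵘ.mkℚᵘ (+ n) 0))
                                                       (toℚᵘ-fromℚᵘ (ℚᵘ.mkℚᵘ (+ 1) k)) ⟩
    ℚᵘ.mkℚᵘ (+ n) 0 ℚᵘ.* ℚᵘ.mkℚᵘ (+ 1) k  ≈⟨ ℚᵘ.*≡* (trans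
                                              (cong (ℤ._* + suc m) (ℤ.*-identityʳ (+ n)))
                                              (trans (sym (ℤ.pos-* n (suc m)))
                                              (trans (cong +_ (trans (sym e) (sym (ℕ.+-identityʳ (suc k)))))
                                              (sym (ℤ.*-identityˡ _))))) ⟩
    ℚᵘ.mkℚᵘ (+ 1) m                       ≈⟨ toℚᵘ-fromℚᵘ (ℚᵘ.mkℚᵘ (+ 1) m) ⟨
    toℚᵘ (1/suc m)                        ∎)
    where open import Relation.Binary.Reasoning.Setoid ℚᵘ.≃-setoid

  next : ∀ q n → ι n * q + q ≡ ι (suc n) * q
  next q n = trans (solve 2 (λ q t → t ⊗ q ⊕ q ⊜ (con 1ℚ ⊕ t) ⊗ q) refl q (ι n))
                   (cong (_* q) (sym (ι-suc n)))

  ∑-upper : ∀ n f q → (∀ i → f i ≤ q) → ∑ n f ≤ ι n * q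
  ∑-upper zero    f q h = ≤-reflexive (sym (*-zeroˡ q))
  ∑-upper (suc n) f q h = subst (_ ≤_) (next q n) (+-mono-≤ (∑-upper n f q h) (h n))

  ∑-lower : ∀ n f q → (∀ i → i ℕ.< n → q ≤ f i) → ι n * q ≤ ∑ n f
  ∑-lower zero    f q h = ≤-reflexive (*-zeroˡ q)
  ∑-lower (suc n) f q h = subst (_≤ _) (next q n)
    (+-mono-≤ (∑-lower n f q (λ i i<n → h i (ℕ.m<n⇒m<1+n i<n))) (h n ℕ.≤-refl))

  module _ (p : ℕ) where

    n : ℕ
    n = suc p

    block : ℕ → ℚ
    block k = ∑ n λ i → 1/suc (n ℕ.* suc k ℕ.+ i)

    harmonic : ∀ k → ∑ (n ℕ.* suc k) 1/suc ≡ ∑ (suc k) 1/suc + lnSum n k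
    harmonic k = ∑-+ (suc k) (p ℕ.* suc k) 1/suc

    step : ∀ k → lnSum n (suc k) + 1/suc (suc k) ≡ lnSum n k + block k
    step k = +-cancelˡ H (trans
      (solve 3 (λ H a b → H ⊕ (a ⊕ b) ⊜ (H ⊕ b) ⊕ a) refl H _ _)
      (trans (sym (harmonic (suc k))) (trans
        (cong (λ t → ∑ t 1/suc) (trans (ℕ.*-suc n (suc k)) (ℕ.+-comm n _)))
        (trans (∑-+ (n ℕ.* suc k) n 1/suc)
          (trans (cong (_+ block k) (harmonic k)) (+-assoc H _ _))))))
      where
      H : ℚ
      H = ∑ (suc k) 1/suc
      +-cancelˡ : ∀ r {a b} → r + a ≡ r + b → a ≡ b
      +-cancelˡ r {a} {b} e = trans (undo r a) (trans (cong (λ t → - r + t) e) (sym (undo r b)))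
        where
        undo : ∀ r a → a ≡ - r + (r + a)
        undo = solve 2 (λ r a → a ⊜ ⊝ r ⊕ (r ⊕ a)) refl

    block-upper : ∀ k → block k ≤ 1/suc k
    block-upper k = subst (block k ≤_) (ι-1/suc n _ k refl)
      (∑-upper n _ (1/suc (k ℕ.+ p ℕ.* suc k)) λ i →
        1/suc-anti (ℕ.≤-trans (ℕ.n≤1+n _) (ℕ.m≤m+n (n ℕ.* suc k) i)))

    block-lower : ∀ k → 1/suc (suc k) ≤ block k
    block-lower k = subst (_≤ block k)
      (ι-1/suc n (n ℕ.* suc k ℕ.+ p) (suc k)
        (trans (sym (ℕ.+-suc _ p)) (trans (ℕ.+-comm _ n) (sym (ℕ.*-suc n (suc k))))))
      (∑-lower n _ _ λ i i<n → 1/suc-anti (ℕ.+-monoʳ-≤ (n ℕ.* suc k) (ℕ.≤-pred i<n)))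

    lower-step : ∀ k → lnSum n k ≤ lnSum n (suc k)
    lower-step k = cancel (subst (lnSum n k + 1/suc (suc k) ≤_) (sym (step k))
      (+-monoʳ-≤ (lnSum n k) (block-lower k)))
      where
      cancel : ∀ {a b r} → a + r ≤ b + r → a ≤ b
      cancel {a} {b} {r} h = subst₂ _≤_ (undo a r) (undo b r) (+-monoˡ-≤ (- r) h)
        where
        undo : ∀ a r → (a + r) + (- r) ≡ a
        undo = solve 2 (λ a r → (a ⊕ r) ⊕ (⊝ r) ⊜ a) refl

    upper-step : ∀ k → lnSum n (suc k) + 1/suc (suc k) ≤ lnSum n k + 1/suc k
    upper-step k = subst (_≤ lnSum n k + 1/suc k) (sym (step k))
      (+-monoʳ-≤ (lnSum n k) (block-upper k))

    sandwich : ∀ N d → lnSum n N ≤ lnSum n (d ℕ.+ N) ×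
      lnSum n (d ℕ.+ N) + 1/suc (d ℕ.+ N) ≤ lnSum n N + 1/suc N
    sandwich N zero    = ≤-refl , ≤-refl
    sandwich N (suc d) = let l , u = sandwich N d in
      ≤-trans l (lower-step (d ℕ.+ N)) , ≤-trans (upper-step (d ℕ.+ N)) u

    enclosed : ∀ N k → N ℕ.≤ k →
      lnSum n N ≤ lnSum n k × lnSum n k ≤ lnSum n N + 1/suc N
    enclosed N k N≤k = let l , u = sandwich′ in l ,
      ≤-trans (subst (_≤ lnSum n k + 1/suc k) (+-identityʳ (lnSum n k))
        (+-monoʳ-≤ (lnSum n k) (1/suc-pos k))) u
      where
      sandwich′ : lnSum n N ≤ lnSum n k × lnSum n k + 1/suc k ≤ lnSum n N + 1/suc N
      sandwich′ = subst (λ j → lnSum n N ≤ lnSum n j ×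
                               lnSum n j + 1/suc j ≤ lnSum n N + 1/suc N)
                        (ℕ.m∸n+n≡m N≤k) (sandwich N (k ℕ.∸ N))

abstract

  lnSum-cauchy : ∀ n → IsCauchy (lnSum n)
  lnSum-cauchy n ε 0<ε = let N , 1/N≤ε = archimedean ε 0<ε in
    N , λ a b N≤a N≤b →
      let la , ua = enclosed (pred n) N a N≤a
          lb , ub = enclosed (pred n) N b N≤b
      in ∣∣-≤ (≤-trans ua (+-mono-≤ lb 1/N≤ε)) (≤-trans ub (+-mono-≤ la 1/N≤ε))

ln : (n : ℕ) .{{_ : NonZero n}} → ℝ
ln n = mkℝ (lnSum n) (lnSum-cauchy n)

-- n cups, additive error c.

module CupGame (n : ℕ) (c : ℝ) where

  Heights : Set
  Heights = Vector ℝ n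

  -- The cups selected so far, most recent first.  Given the adversary's
  -- strategy they determine the whole course of the game, so a fully adaptive
  -- adversary is a function of them.
  History : Set
  History = List (Fin n)

  remove : Fin n → Heights → Heights
  remove i g = updateAt g i λ x → (x -ᴿ 1ℝ) ⊔ᴿ 0ℝ

  mutual

    -- Heights at the start of the step following the given history.
    start : (History → Vector ℝ n) → History → Heights
    start pour []      _ = 0ℝ
    start pour (i ∷ h)   = remove i (filled pour h)

    -- Heights in that step after the adversary has poured and before the
    -- player has removed.
    filled : (History → Vector ℝ n) → History → Heights
    filled pour h j = start pour h j +ᴿ pour h j

  record Strategy : Set where
    field
      pour           : History → Vector ℝ n
      pour-nonneg    : ∀ h j → 0ℝ ≤ᴿ pour h j
      pour-unit      : ∀ h → sumᴿ (pour h) ≈ᴿ 1ℝ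
      estimate       : History → Vector ℝ n
      estimate-lower : ∀ h j → filled pour h j ≤ᴿ estimate h j
      estimate-upper : ∀ h j → estimate h j ≤ᴿ filled pour h j +ᴿ c

  open Strategy

  -- The cup selected at each time step.
  Play : Set
  Play = ℕ → Fin n

  history : Play → ℕ → History
  history p zero    = []
  history p (suc t) = p t ∷ history p t

  -- Every tie-breaking is allowed.
  Greedy : Strategy → Play → Set
  Greedy σ p = ∀ t j → estimate σ (history p t) j ≤ᴿ estimate σ (history p t) (p t)

  data HeightIn (σ : Strategy) (p : Play) : ℝ → Set where
    at-start     : ∀ t i → HeightIn σ p (start  (pour σ) (history p t) i)
    intermediate : ∀ t i → HeightIn σ p (filled (pour σ) (history p t) i)

  BacklogAtLeast : Strategy → Play → ℝ → Set
  BacklogAtLeast σ p B = B ≤sup HeightIn σ p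

  -- The first component excludes vacuous truth: constructively, a maximum of
  -- finitely many reals need not be attained at an index one can exhibit, so
  -- the existence of a greedy play is not automatic.
  ForcesBacklog : Strategy → ℝ → Set
  ForcesBacklog σ B =
    ∃ (Greedy σ) × (∀ p → Greedy σ p → BacklogAtLeast σ p B)

{-# OPTIONS --safe #-}

-- The adversary can dictate every move of greedy: it shows one designated cup
-- (the decoy) with error e, slightly below c, and all others exactly, so that greedy
-- must take the decoy as soon as its height plus e exceeds all other heights.
-- Let D < e + 1, and start from k + 1 cups at height a, the others being no
-- higher.  Take one of the k + 1 as decoy.  In each step pour θ = s / (k + 1) into each of the
-- remaining k and the rest, 1 - kθ = 1 - s + θ, into the decoy; as greedy removes 1 from it, the gap
-- between the k cups and the decoy grows by at most s.  The decoy stays eligible until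
-- the gap reaches D, so that D / s steps bring the k cups to a + D / (k + 1).
-- Starting from n empty cups, a cup reaches D (1/2 + ⋯ + 1/n).

module Submission where

open import Defs
open import Data.Nat as ℕ using (ℕ; zero; suc; NonZero)
import Data.Nat.Properties as ℕ
import Data.Integer as ℤ
import Data.Integer.Properties as ℤ
open import Data.Rational using
  (ℚ; mkℚ; 0ℚ; 1ℚ; _+_; _*_; -_; _-_; _⊔_; ∣_∣; _≤_; _<_; _/_; *≤*; nonNegative; toℚᵘ; fromℚᵘ)
open import Data.Rational.Properties
import Data.Rational.Unnormalised as ℚᵘ
import Data.Rational.Unnormalised.Properties as ℚᵘ
open import Data.Rational.Solver using (module +-*-Solver)
open import Data.Fin as Fin using (Fin; zero; suc; toℕ; fromℕ<)
import Data.Fin.Properties as Fin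
open import Data.List using ([]; _∷_; length; allFin)
open import Relation.Binary using (DecTotalOrder)
open import Data.List.Extrema (DecTotalOrder.totalOrder ≤-decTotalOrder) using (argmax; f[xs]≤f[argmax])
open import Data.List.Membership.Propositional.Properties using (∈-allFin)
import Data.List.Relation.Unary.All as All
open import Data.Vec.Functional using (Vector; foldr; updateAt)
open import Data.Vec.Functional.Properties using (updateAt-updates; updateAt-minimal)
open import Data.Product using (Σ-syntax; ∃; _×_; _,_; proj₁; proj₂)
open import Data.Sum using (inj₁; inj₂)
open import Function using (id)
open import Relation.Nullary using (¬_; yes; no; contradiction)
open import Relation.Binary.PropositionalEquality

open +-*-Solver using (solve; con) renaming
  (_:+_ to _⊕_; _:*_ to _⊗_; :-_ to ⊝_; _:-_ to _⊖_; _:=_ to _⊜_)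

-- Rational arithmetic

p≤p+q : ∀ p {q} → 0ℚ ≤ q → p ≤ p + q
p≤p+q p {q} 0≤q = subst (_≤ p + q) (+-identityʳ p) (+-monoʳ-≤ p 0≤q)

*-monoˡ : ∀ {p q} r → 0ℚ ≤ r → p ≤ q → r * p ≤ r * q
*-monoˡ r 0≤r = *-monoˡ-≤-nonNeg r {{nonNegative 0≤r}}

*-nonneg : ∀ {p q} → 0ℚ ≤ p → 0ℚ ≤ q → 0ℚ ≤ p * q
*-nonneg {p} {q} 0≤p 0≤q = subst (_≤ p * q) (*-zeroʳ p) (*-monoˡ p 0≤p 0≤q)

p≤q⇒0≤q-p : ∀ {p q} → p ≤ q → 0ℚ ≤ q - p
p≤q⇒0≤q-p {p} {q} p≤q = subst (_≤ q - p) (+-inverseʳ p) (+-monoˡ-≤ (- p) p≤q)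

∣p-q∣≤r⇒p≤q+r : ∀ {p q r} → ∣ p - q ∣ ≤ r → p ≤ q + r
∣p-q∣≤r⇒p≤q+r {p} {q} {r} h = subst (_≤ q + r)
  (solve 2 (λ p q → q ⊕ (p ⊖ q) ⊜ p) refl p q)
  (+-monoʳ-≤ q (≤-trans (p≤∣p∣ (p - q)) h))
  where
  p≤∣p∣ : ∀ p → p ≤ ∣ p ∣
  p≤∣p∣ p with ≤-total 0ℚ p
  ... | inj₁ 0≤p = ≤-reflexive (sym (0≤p⇒∣p∣≡p 0≤p))
  ... | inj₂ p≤0 = ≤-trans p≤0 (0≤∣p∣ p)

p≤q+ε⇒p≤q : ∀ {p q} → (∀ ε → 0ℚ < ε → p ≤ q + ε) → p ≤ q
p≤q+ε⇒p≤q {p} {q} h = ≮⇒≥ λ q<p →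
  let r , q<r , r<p = <-dense q<p
  in <-irrefl refl (<-≤-trans r<p (subst (p ≤_) (solve 2 (λ q r → q ⊕ (r ⊖ q) ⊜ r) refl q r)
       (h (r - q) (subst (_< r - q) (+-inverseʳ q) (+-monoˡ-< (- q) q<r)))))

1/suc-pos : ∀ k → 0ℚ < 1/suc k
1/suc-pos k = positive⁻¹ (1/suc k) {{normalize-pos 1 (suc k)}}

1/suc-antimono : ∀ {a b} → a ℕ.≤ b → 1/suc b ≤ 1/suc a
1/suc-antimono {a} {b} a≤b = fromℚᵘ-mono-≤ {ℚᵘ.mkℚᵘ (ℤ.+ 1) b} {ℚᵘ.mkℚᵘ (ℤ.+ 1) a}
  (ℚᵘ.*≤* (ℤ.*-monoˡ-≤-nonNeg (ℤ.+ 1) (ℤ.+≤+ (ℕ.s≤s a≤b))))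
  where
  fromℚᵘ-mono-≤ : ∀ {p q} → p ℚᵘ.≤ q → fromℚᵘ p ≤ fromℚᵘ q
  fromℚᵘ-mono-≤ {p} {q} p≤q = toℚᵘ-cancel-≤
    (ℚᵘ.≤-respˡ-≃ (ℚᵘ.≃-sym (toℚᵘ-fromℚᵘ p)) (ℚᵘ.≤-respʳ-≃ (ℚᵘ.≃-sym (toℚᵘ-fromℚᵘ q)) p≤q))

1/suc≤1 : ∀ k → 1/suc k ≤ 1ℚ
1/suc≤1 k = 1/suc-antimono {b = k} ℕ.z≤n

-- Finite sums

∑-+ : ∀ a b f → ∑ (a ℕ.+ b) f ≡ ∑ a f + ∑ b (λ i → f (a ℕ.+ i))
∑-+ a zero    f rewrite ℕ.+-identityʳ a = sym (+-identityʳ _)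
∑-+ a (suc b) f rewrite ℕ.+-suc a b =
  trans (cong (_+ f (a ℕ.+ b)) (∑-+ a b f)) (+-assoc (∑ a f) _ _)

∑-mono : ∀ n {f g} → (∀ i → f i ≤ g i) → ∑ n f ≤ ∑ n g
∑-mono zero    f≤g = ≤-refl
∑-mono (suc n) f≤g = +-mono-≤ (∑-mono n f≤g) (f≤g n)

∑-nonneg : ∀ n {f} → (∀ i → 0ℚ ≤ f i) → 0ℚ ≤ ∑ n f
∑-nonneg zero    0≤f = ≤-refl
∑-nonneg (suc n) 0≤f = +-mono-≤ (∑-nonneg n 0≤f) (0≤f n)

∑-distribˡ : ∀ n q f → ∑ n (λ i → q * f i) ≡ q * ∑ n f
∑-distribˡ zero    q f = sym (*-zeroʳ q)
∑-distribˡ (suc n) q f =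
  trans (cong (_+ q * f n) (∑-distribˡ n q f)) (sym (*-distribˡ-+ q (∑ n f) (f n)))

∑-const-1/suc : ∀ n d → ∑ n (λ _ → 1/suc d) ≡ ℤ.+ n / suc d
∑-const-1/suc zero    d = sym (0/n≡0 (suc d))
∑-const-1/suc (suc n) d = trans (cong (_+ 1/suc d) (∑-const-1/suc n d))
  (trans (+-comm (ℤ.+ n / suc d) (1/suc d)) (toℚᵘ-injective (begin
    toℚᵘ (1/suc d + ℤ.+ n / suc d)                ≈⟨ toℚᵘ-homo-+ (1/suc d) (ℤ.+ n / suc d) ⟩
    toℚᵘ (1/suc d) ℚᵘ.+ toℚᵘ (ℤ.+ n / suc d)      ≈⟨ ℚᵘ.+-cong (toℚᵘ-fromℚᵘ (ℚᵘ.mkℚᵘ (ℤ.+ 1) d))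
                                                                 (toℚᵘ-fromℚᵘ (ℚᵘ.mkℚᵘ (ℤ.+ n) d)) ⟩
    ℚᵘ.mkℚᵘ (ℤ.+ 1) d ℚᵘ.+ ℚᵘ.mkℚᵘ (ℤ.+ n) d        ≈⟨ ℚᵘ.*≡* (trans
                                                     (cong (ℤ._* ℤ.+ suc d) (sym (ℤ.*-distribʳ-+ (ℤ.+ suc d) (ℤ.+ 1) (ℤ.+ n))))
                                                     (ℤ.*-assoc (ℤ.+ suc n) (ℤ.+ suc d) (ℤ.+ suc d))) ⟩
    ℚᵘ.mkℚᵘ (ℤ.+ suc n) d                         ≈⟨ toℚᵘ-fromℚᵘ (ℚᵘ.mkℚᵘ (ℤ.+ suc n) d) ⟨
    toℚᵘ (ℤ.+ suc n / suc d)                      ∎)))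
  where open import Relation.Binary.Reasoning.Setoid ℚᵘ.≃-setoid

∑-const-cancel : ∀ {n k} m → suc k ≡ n ℕ.* suc m → ∑ n (λ _ → 1/suc k) ≡ 1/suc m
∑-const-cancel {n} {k} m e = trans (∑-const-1/suc n k)
  (fromℚᵘ-cong {ℚᵘ.mkℚᵘ (ℤ.+ n) k} {ℚᵘ.mkℚᵘ (ℤ.+ 1) m} (ℚᵘ.*≡* (trans (sym (ℤ.pos-* n (suc m)))
    (trans (cong ℤ.+_ (sym e)) (sym (ℤ.*-identityˡ (ℤ.+ suc k)))))))

∑-const-1 : ∀ k → ∑ (suc k) (λ _ → 1/suc k) ≡ 1ℚ
∑-const-1 k = ∑-const-cancel {suc k} 0 (sym (ℕ.*-identityʳ (suc k)))

-- For `n = p + 1` this is `1/2 + ⋯ + 1/n`. The summand `1` is left out because a phase needs at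
-- least two level cups, one of them the decoy.
harmonic : ℕ → ℚ
harmonic p = ∑ p λ l → 1/suc (suc l)

-- With `m = k + 1`, the Riemann sum splits into `p` blocks of `m` terms. In block `j`, counted from
-- `0`, every term is at most `1/((j + 1) m)`, so the block is at most `1/(j + 1)`. The bound is
-- uniform in `k`, hence valid at every approximation of `ln n`.
lnSum≤harmonic+1 : ∀ p k → lnSum (suc p) k ≤ 1ℚ + harmonic p
lnSum≤harmonic+1 p k = ≤-trans (blocks p) (subst (∑ p 1/suc ≤_) (shift p) (p≤p+q _ (<⇒≤ (1/suc-pos p))))
  where
  term : ℕ → ℚ
  term i = 1/suc (suc k ℕ.+ i)

  blocks : ∀ p → ∑ (p ℕ.* suc k) term ≤ ∑ p 1/suc
  blocks zero    = ≤-refl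
  blocks (suc p) = subst (_≤ ∑ p 1/suc + 1/suc p)
    (trans (sym (∑-+ (p ℕ.* suc k) (suc k) term)) (cong (λ t → ∑ t term) (ℕ.+-comm (p ℕ.* suc k) (suc k))))
    (+-mono-≤ (blocks p) (subst (∑ (suc k) (λ i → term (p ℕ.* suc k ℕ.+ i)) ≤_)
      (∑-const-cancel {suc k} p (ℕ.*-comm (suc p) (suc k)))
      (∑-mono (suc k) λ i → 1/suc-antimono
        (ℕ.≤-trans (ℕ.n≤1+n _) (ℕ.+-monoʳ-≤ (suc k) (ℕ.m≤m+n (p ℕ.* suc k) i))))))

  shift : ∀ p → ∑ p 1/suc + 1/suc p ≡ 1ℚ + harmonic p
  shift zero    = refl
  shift (suc p) = trans (cong (_+ 1/suc (suc p)) (shift p)) (+-assoc 1ℚ (harmonic p) _)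

harmonic-nonneg : ∀ p → 0ℚ ≤ harmonic p
harmonic-nonneg p = ∑-nonneg p λ l → <⇒≤ (1/suc-pos (suc l))

-- An error of `1/n` in `D` is multiplied by `harmonic p` in the backlog; this keeps the total loss
-- bounded.
1/suc*harmonic≤1 : ∀ p → 1/suc p * harmonic p ≤ 1ℚ
1/suc*harmonic≤1 p = subst₂ _≤_ (∑-distribˡ p (1/suc p) _) (∑-const-1 p)
  (≤-trans (∑-mono p λ l → subst (1/suc p * 1/suc (suc l) ≤_) (*-identityʳ (1/suc p))
      (*-monoˡ (1/suc p) (<⇒≤ (1/suc-pos p)) (1/suc≤1 (suc l))))
    (p≤p+q _ (<⇒≤ (1/suc-pos p))))

-- A nonnegative rational is its numerator times the reciprocal of its denominator. A phase can thus
-- consist of whole steps that use up `D` exactly, with no rounding.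
equal-parts : ∀ {D} → 0ℚ ≤ D → Σ[ N ∈ ℕ ] Σ[ d ∈ ℕ ] ∑ N (λ _ → 1/suc d) ≡ D
equal-parts {D@(mkℚ (ℤ.+ N) d _)} _ = N , d , trans (∑-const-1/suc N d) (↥p/↧p≡p D)
equal-parts {mkℚ (ℤ.-[1+ _ ]) _ _} (*≤* ())

-- The adversary on rational heights

-- Serves two purposes: with `f` evaluating a real at an index it carries real heights to rational
-- ones through a removal; with `f = id` it preserves pointwise equality of heights.
updateAt-natural : ∀ {A B : Set} {n} {f : A → B} {g : A → A} {g′ : B → B} {xs : Vector A n} {ys} →
  (∀ x → f (g x) ≡ g′ (f x)) → (∀ j → f (xs j) ≡ ys j) →
  ∀ i j → f (updateAt xs i g j) ≡ updateAt ys i g′ j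
updateAt-natural {n = suc n} {g′ = g′} nat eq zero zero = trans (nat _) (cong g′ (eq zero))
updateAt-natural {n = suc n} nat eq zero    (suc j) = eq (suc j)
updateAt-natural {n = suc n} nat eq (suc i) zero    = eq zero
updateAt-natural {n = suc n} nat eq (suc i) (suc j) = updateAt-natural nat (λ j → eq (suc j)) i j

-- The active cups of a phase form an initial segment of the indices with the decoy last, so
-- dropping the decoy leaves an initial segment again.
spread : ∀ {n} → Fin n → ℚ → ℚ → Vector ℚ n
spread zero    θ r zero    = r
spread zero    θ r (suc j) = 0ℚ
spread (suc i) θ r zero    = θ
spread (suc i) θ r (suc j) = spread i θ r j

spread-< : ∀ {n} {i j : Fin n} θ r → j Fin.< i → spread i θ r j ≡ θ
spread-< {i = suc i} {zero}  θ r _           = refl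
spread-< {i = suc i} {suc j} θ r (ℕ.s≤s j<i) = spread-< θ r j<i

spread-≡ : ∀ {n} (i : Fin n) θ r → spread i θ r i ≡ r
spread-≡ zero    θ r = refl
spread-≡ (suc i) θ r = spread-≡ i θ r

spread-≢ : ∀ {n} {i j : Fin n} {θ} r → 0ℚ ≤ θ → j ≢ i → spread i θ r j ≤ θ
spread-≢ {i = zero}  {zero}  r 0≤θ j≢i = contradiction refl j≢i
spread-≢ {i = zero}  {suc j} r 0≤θ j≢i = 0≤θ
spread-≢ {i = suc i} {zero}  r 0≤θ j≢i = ≤-refl
spread-≢ {i = suc i} {suc j} r 0≤θ j≢i = spread-≢ r 0≤θ λ e → j≢i (cong suc e)

spread-nonneg : ∀ {n} (i j : Fin n) {θ r} → 0ℚ ≤ θ → 0ℚ ≤ r → 0ℚ ≤ spread i θ r j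
spread-nonneg zero    zero    0≤θ 0≤r = 0≤r
spread-nonneg zero    (suc j) 0≤θ 0≤r = ≤-refl
spread-nonneg (suc i) zero    0≤θ 0≤r = 0≤θ
spread-nonneg (suc i) (suc j) 0≤θ 0≤r = spread-nonneg i j 0≤θ 0≤r

sum-spread : ∀ {n} (i : Fin n) θ r → foldr _+_ 0ℚ (spread i θ r) ≡ ∑ (toℕ i) (λ _ → θ) + r
sum-spread {suc n} zero θ r = trans (cong (r +_) (zeros n)) (trans (+-identityʳ r) (sym (+-identityˡ r)))
  where
  zeros : ∀ n → foldr _+_ 0ℚ {n} (λ _ → 0ℚ) ≡ 0ℚ
  zeros zero    = refl
  zeros (suc n) = trans (+-identityˡ _) (zeros n)
sum-spread (suc i) θ r = trans (cong (θ +_) (sum-spread i θ r))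
  (solve 3 (λ θ S r → θ ⊕ (S ⊕ r) ⊜ (S ⊕ θ) ⊕ r) refl θ (∑ (toℕ i) (λ _ → θ)) r)

record Move (n : ℕ) : Set where
  field
    amount   : Vector ℚ n
    nonneg   : ∀ j → 0ℚ ≤ amount j
    total    : foldr _+_ 0ℚ amount ≡ 1ℚ
    decoy    : Fin n

open Move

module _ {n : ℕ} where

  infixl 6 _⊞_

  _⊞_ : Vector ℚ n → Vector ℚ n → Vector ℚ n
  (g ⊞ v) j = g j + v j

  drain : Fin n → Vector ℚ n → Vector ℚ n
  drain i g = updateAt g i λ x → (x - 1ℚ) ⊔ 0ℚ

  -- A script without branching suffices: the strict inequality in `play` leaves greedy only the
  -- decoy, however ties are broken.
  data Forces (e : ℚ) (g : Vector ℚ n) (B : ℚ) : Set where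
    reached : ∀ i → B ≤ g i → Forces e g B
    play    : (m : Move n) →
      (∀ j → j ≢ decoy m → (g ⊞ amount m) j < (g ⊞ amount m) (decoy m) + e) →
      Forces e (drain (decoy m) (g ⊞ amount m)) B → Forces e g B

  module Adversary {D e s : ℚ} (0≤s : 0ℚ ≤ s) (s≤1 : s ≤ 1ℚ) (D<1+e : D < 1ℚ + e)
                   (N : ℕ) (Ns≡D : ∑ N (λ _ → s) ≡ D) where

    module Phase (i : Fin n) where

      θ x : ℚ
      θ = s * 1/suc (toℕ i)
      x = (1ℚ - s) + θ

      0≤θ : 0ℚ ≤ θ
      0≤θ = *-nonneg 0≤s (<⇒≤ (1/suc-pos (toℕ i)))

      pouring : Move n
      pouring = record
        { amount = spread i θ x
        ; nonneg = λ j → spread-nonneg i j 0≤θ (+-mono-≤ (p≤q⇒0≤q-p s≤1) 0≤θ)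
        ; total  = trans (sum-spread i θ x)
            (trans (solve 3 (λ S s θ → S ⊕ ((con 1ℚ ⊖ s) ⊕ θ) ⊜ (S ⊕ θ) ⊕ (con 1ℚ ⊖ s)) refl
                      (∑ (toℕ i) (λ _ → θ)) s θ)
            (trans (cong (_+ (1ℚ - s)) (trans (∑-distribˡ (suc (toℕ i)) s _)
                      (trans (cong (s *_) (∑-const-1 (toℕ i))) (*-identityʳ s))))
                   (solve 1 (λ s → s ⊕ (con 1ℚ ⊖ s) ⊜ con 1ℚ) refl s)))
        ; decoy  = i
        }

      -- d bounds the gap between the decoy i and the cups below it in the
      -- index order, r is the number of steps left.
      run : ∀ r {B d a g} → 0ℚ ≤ a → (∀ j → j Fin.< i → g j ≡ a) → (∀ j → g j ≤ a) →
        a ≤ g i + d → d + ∑ r (λ _ → s) ≤ D →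
        (∀ {a′ g′} → a′ ≡ a + ∑ r (λ _ → θ) → 0ℚ ≤ a′ →
          (∀ j → j Fin.< i → g′ j ≡ a′) → (∀ j → g′ j ≤ a′) → Forces e g′ B) →
        Forces e g B
      -- Only the invariant describes the heights at the end of a phase, so they are passed on to
      -- the continuation `cont`.
      run zero {a = a} 0≤a active below gap rest cont =
        cont (sym (+-identityʳ a)) 0≤a active below
      run (suc r) {_} {d} {a} {g} 0≤a active below gap rest cont =
        play pouring legal (run r (≤-trans 0≤a (p≤p+q a 0≤θ)) active′ below′ gap′
          (subst (_≤ D) (solve 3 (λ d S s → d ⊕ (S ⊕ s) ⊜ (d ⊕ s) ⊕ S) refl d (∑ r (λ _ → s)) s) rest)
          λ e → cont (trans e
            (solve 3 (λ a θ S → (a ⊕ θ) ⊕ S ⊜ a ⊕ (S ⊕ θ)) refl a θ (∑ r (λ _ → θ)))))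
        where
        f g′ : Vector ℚ n
        f  = g ⊞ spread i θ x
        g′ = drain i f

        fi≡ : f i ≡ g i + x
        fi≡ = cong (g i +_) (spread-≡ i θ x)

        g′i≡ : g′ i ≡ (g i + x - 1ℚ) ⊔ 0ℚ
        g′i≡ = trans (updateAt-updates i f) (cong (λ t → (t - 1ℚ) ⊔ 0ℚ) fi≡)

        f≤ : ∀ {j} → j ≢ i → f j ≤ a + θ
        f≤ {j} j≢i = +-mono-≤ (below j) (spread-≢ x 0≤θ j≢i)

        d+s≤D : d + s ≤ D
        d+s≤D = ≤-trans (+-monoʳ-≤ d (subst (_≤ ∑ r (λ _ → s) + s) (+-identityˡ s)
          (+-monoˡ-≤ s (∑-nonneg r λ _ → 0≤s)))) rest

        d+s-1<e : (d + s) - 1ℚ < e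
        d+s-1<e = subst ((d + s) - 1ℚ <_) (solve 1 (λ e → (con 1ℚ ⊕ e) ⊖ con 1ℚ ⊜ e) refl e)
          (+-monoˡ-< (- 1ℚ) (≤-<-trans d+s≤D D<1+e))

        legal : ∀ j → j ≢ i → f j < f i + e
        -- The decoy receives `1 - s` more than an active cup, so after pouring no cup exceeds it by
        -- more than `d + s - 1`, which is below `e` because `d + s ≤ D < 1 + e`.
        legal j j≢i = ≤-<-trans (f≤ j≢i) (≤-<-trans (+-monoˡ-≤ θ gap)
          (subst₂ _<_
            (solve 4 (λ g d s θ → (g ⊕ ((con 1ℚ ⊖ s) ⊕ θ)) ⊕ ((d ⊕ s) ⊖ con 1ℚ) ⊜ (g ⊕ d) ⊕ θ) refl (g i) d s θ)
            (cong (_+ e) (sym fi≡))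
            (+-monoʳ-< (g i + x) d+s-1<e)))

        active′ : ∀ j → j Fin.< i → g′ j ≡ a + θ
        active′ j j<i = trans (updateAt-minimal j i f (Fin.<⇒≢ j<i))
          (cong₂ _+_ (active j j<i) (spread-< θ x j<i))

        below′ : ∀ j → g′ j ≤ a + θ
        below′ j with j Fin.≟ i
        ... | no  j≢i  = subst (_≤ a + θ) (sym (updateAt-minimal j i f j≢i)) (f≤ j≢i)
        -- The decoy loses `s` relative to the level, unless it is emptied; in that case `0 ≤ a`
        -- keeps it below the level.
        ... | yes refl = subst (_≤ a + θ) (sym g′i≡) (⊔-lub
          (subst₂ _≤_
            (solve 3 (λ g s θ → (g ⊕ θ) ⊕ (⊝ s) ⊜ (g ⊕ ((con 1ℚ ⊖ s) ⊕ θ)) ⊖ con 1ℚ) refl (g i) s θ)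
            (+-identityʳ (a + θ))
            (+-mono-≤ (+-monoˡ-≤ θ (below i)) (neg-antimono-≤ 0≤s)))
          (≤-trans 0≤a (p≤p+q a 0≤θ)))

        gap′ : a + θ ≤ g′ i + (d + s)
        -- Truncation at `0` can only raise the decoy, so it cannot widen the gap beyond `d + s`.
        gap′ = ≤-trans (+-monoˡ-≤ θ gap) (subst₂ _≤_
          (solve 4 (λ g d s θ → ((g ⊕ ((con 1ℚ ⊖ s) ⊕ θ)) ⊖ con 1ℚ) ⊕ (d ⊕ s) ⊜ (g ⊕ d) ⊕ θ) refl (g i) d s θ)
          (cong (_+ (d + s)) (sym g′i≡))
          (+-monoˡ-≤ (d + s) (p≤p⊔q (g i + x - 1ℚ) 0ℚ)))

    -- Each phase takes the active cup of highest index as decoy and gains the last summand of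
    -- `harmonic` times `D`. The induction ends with a single cup at the level, where `harmonic 0`
    -- is `0`.
    force : ∀ k → k ℕ.< n → ∀ {a g} → 0ℚ ≤ a →
      (∀ j → toℕ j ℕ.≤ k → g j ≡ a) → (∀ j → g j ≤ a) → Forces e g (a + D * harmonic k)
    force zero 0<n {a} {g} 0≤a active below = reached (fromℕ< 0<n) (≤-reflexive
      (trans (cong (a +_) (*-zeroʳ D)) (trans (+-identityʳ a)
        (sym (active (fromℕ< 0<n) (ℕ.≤-reflexive (Fin.toℕ-fromℕ< 0<n)))))))
    force (suc k) k<n {a} {g} 0≤a active below =
      run N 0≤a (λ j j<i → active j (subst (toℕ j ℕ.≤_) i≡ (ℕ.<⇒≤ j<i))) below
        -- The decoy starts at the level, with gap `0`, so all of `D` is available to the `N` steps.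
        (≤-reflexive (sym (trans (+-identityʳ (g i)) (active i (ℕ.≤-reflexive i≡)))))
        (≤-reflexive (trans (+-identityˡ _) Ns≡D))
        λ {a′} a′≡ 0≤a′ active′ below′ → subst (Forces e _)
          (trans (cong (_+ D * harmonic k) (trans a′≡ (cong (a +_) gain)))
            (solve 4 (λ a D w H → (a ⊕ w ⊗ D) ⊕ D ⊗ H ⊜ a ⊕ D ⊗ (H ⊕ w)) refl a D _ (harmonic k)))
          (force k (ℕ.<⇒≤ k<n) 0≤a′
            (λ j j≤k → active′ j (subst (toℕ j ℕ.<_) (sym i≡) (ℕ.s≤s j≤k))) below′)
      where
      i : Fin n
      i = fromℕ< k<n
      open Phase i
      i≡ : toℕ i ≡ suc k
      i≡ = Fin.toℕ-fromℕ< k<n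
      gain : ∑ N (λ _ → θ) ≡ 1/suc (suc k) * D
      gain = trans (cong (λ t → ∑ N (λ _ → t)) (trans (*-comm s _) (cong (λ t → 1/suc t * s) i≡)))
        (trans (∑-distribˡ N (1/suc (suc k)) _) (cong (1/suc (suc k) *_) Ns≡D))

empty-forces : ∀ p {D e} → 0ℚ ≤ D → D < 1ℚ + e → Forces {suc p} e (λ _ → 0ℚ) (D * harmonic p)
empty-forces p {D} 0≤D D<1+e = let N , d , Nd≡D = equal-parts 0≤D in
  subst (Forces _ _) (+-identityˡ (D * harmonic p))
    (Adversary.force (<⇒≤ (1/suc-pos d)) (1/suc≤1 d) D<1+e N Nd≡D p ℕ.≤-refl ≤-refl
      (λ _ _ → refl) (λ _ → ≤-refl))

-- Playing the rational adversary in the real game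

sum-seq : ∀ {n} (v : Vector ℚ n) k → seq (sumᴿ λ j → fromℚ (v j)) k ≡ foldr _+_ 0ℚ v
sum-seq {zero}  v k = refl
sum-seq {suc n} v k = cong (v zero +_) (sum-seq (λ j → v (suc j)) k)

≤⇒≤ᴿ : ∀ {x y} → (∀ k → seq x k ≤ seq y k) → x ≤ᴿ y
≤⇒≤ᴿ x≤y ε 0<ε = 0 , λ k _ → ≤-trans (x≤y k) (p≤p+q _ (<⇒≤ 0<ε))

≤ᴿ⇒≤ : ∀ {x y p q} → (∀ k → seq x k ≡ p) → (∀ k → seq y k ≡ q) → x ≤ᴿ y → p ≤ q
≤ᴿ⇒≤ {q = q} x≡p y≡q x≤y = p≤q+ε⇒p≤q λ ε 0<ε →
  let N , h = x≤y ε 0<ε in subst₂ _≤_ (x≡p N) (cong (_+ ε) (y≡q N)) (h N ℕ.≤-refl)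

-- A strategy must go on after the target is reached; from then on any valid pouring will do.
default-move : ∀ p → Move (suc p)
default-move p = record
  { amount = spread zero 0ℚ 1ℚ
  ; nonneg = λ j → spread-nonneg zero j ≤-refl (<⇒≤ (1/suc-pos 0))
  ; total  = trans (sum-spread {suc p} zero 0ℚ 1ℚ) (+-identityˡ 1ℚ)
  ; decoy  = zero
  }

moves : ∀ {p e g B} → Forces {suc p} e g B → ℕ → Move (suc p)
moves {p} (reached i B≤gi) t = default-move p
moves (play m legal F) zero    = m
moves (play m legal F) (suc t) = moves F t

module FollowMoves {p : ℕ} {c : ℝ} {e : ℚ} (0≤e : 0ℚ ≤ e) (e≤c : fromℚ e ≤ᴿ c)
                   (μ : ℕ → Move (suc p)) where

  open CupGame (suc p) c

  -- Only the elapsed time is read off the history, as the script predicts greedy's selections. All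
  -- amounts are constant sequences, so heights and estimates are constant too and can be compared
  -- as rationals.
  pourᴿ : History → Vector ℝ (suc p)
  pourᴿ h j = fromℚ (amount (μ (length h)) j)

  startℚ filledℚ : History → Vector ℚ (suc p)
  startℚ []      _ = 0ℚ
  startℚ (i ∷ h)   = drain i (filledℚ h)
  filledℚ h = startℚ h ⊞ amount (μ (length h))

  seq-start  : ∀ h j k → seq (start pourᴿ h j) k ≡ startℚ h j
  seq-filled : ∀ h j k → seq (filled pourᴿ h j) k ≡ filledℚ h j
  seq-start []      j k = refl
  seq-start (i ∷ h) j k =
    updateAt-natural {f = λ x → seq x k} (λ _ → refl) (λ j → seq-filled h j k) i j
  seq-filled h j k = cong (_+ _) (seq-start h j k)

  bonus : Fin (suc p) → Vector ℚ (suc p)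
  bonus i = updateAt (λ _ → 0ℚ) i λ _ → e

  bonus-bounds : ∀ i j → 0ℚ ≤ bonus i j × bonus i j ≤ e
  bonus-bounds i j with j Fin.≟ i
  ... | yes refl rewrite updateAt-updates i {λ _ → e} (λ _ → 0ℚ) = 0≤e , ≤-refl
  ... | no  j≢i  rewrite updateAt-minimal j i {λ _ → e} (λ _ → 0ℚ) j≢i = ≤-refl , 0≤e

  estimateᴿ : History → Vector ℝ (suc p)
  estimateᴿ h j = filled pourᴿ h j +ᴿ fromℚ (bonus (decoy (μ (length h))) j)

  estimateℚ : History → Vector ℚ (suc p)
  estimateℚ h = filledℚ h ⊞ bonus (decoy (μ (length h)))

  seq-estimate : ∀ h j k → seq (estimateᴿ h j) k ≡ estimateℚ h j
  seq-estimate h j k = cong (_+ _) (seq-filled h j k)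

  strategy : Strategy
  strategy = record
    { pour           = pourᴿ
    ; pour-nonneg    = λ h j → ≤⇒≤ᴿ {0ℝ} {pourᴿ h j} λ k → nonneg (μ (length h)) j
    ; pour-unit      = λ h ε 0<ε → 0 , λ k _ → subst (_≤ ε)
        (cong (λ t → ∣ t - 1ℚ ∣)
          (sym (trans (sum-seq (amount (μ (length h))) k) (total (μ (length h))))))
        (<⇒≤ 0<ε)
    ; estimate       = estimateᴿ
    ; estimate-lower = λ h j → ≤⇒≤ᴿ {filled pourᴿ h j} {estimateᴿ h j} λ k →
        p≤p+q _ (proj₁ (bonus-bounds (decoy (μ (length h))) j))
    ; estimate-upper = λ h j ε 0<ε → let N , e≤ = e≤c ε 0<ε in N , λ k N≤k →
        subst (seq (estimateᴿ h j) k ≤_) (sym (+-assoc (seq (filled pourᴿ h j) k) (seq c k) ε))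
          (+-monoʳ-≤ (seq (filled pourᴿ h j) k)
            (≤-trans (proj₂ (bonus-bounds (decoy (μ (length h))) j)) (e≤ k N≤k)))
    }

  -- Rational estimates have a computable maximum. Since each selection depends on the earlier ones,
  -- the histories `past` are built first and then identified with those of the resulting play.
  greedy-play : ∃ (Greedy strategy)
  greedy-play = (λ t → choose (past t)) , λ t j → ≤⇒≤ᴿ {estimateᴿ (history _ t) j} {estimateᴿ (history _ t) _} λ k →
    subst₂ _≤_ (sym (seq-estimate (history _ t) j k)) (sym (seq-estimate (history _ t) _ k))
      (subst (λ h → estimateℚ h j ≤ estimateℚ h (choose (past t))) (sym (history≡past t))
        (All.lookup (f[xs]≤f[argmax] {f = estimateℚ (past t)} zero (allFin (suc p))) (∈-allFin j)))
    where
    choose : History → Fin (suc p)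
    choose h = argmax (estimateℚ h) zero (allFin (suc p))
    past : ℕ → History
    past zero    = []
    past (suc t) = choose (past t) ∷ past t
    history≡past : ∀ t → history (λ t → choose (past t)) t ≡ past t
    history≡past zero    = refl
    history≡past (suc t) = cong (choose (past t) ∷_) (history≡past t)

  module _ {q : Play} (greedy : Greedy strategy q) where

    length-history : ∀ t → length (history q t) ≡ t
    length-history zero    = refl
    length-history (suc t) = cong suc (length-history t)

    -- Induction on the script: at time `t`, what is left of `μ` is the script of the remaining `F`,
    -- and greedy's selection of the decoy brings the game to the heights from which that remainder
    -- starts.
    follow : ∀ {g B} (F : Forces e g B) t → (∀ j → startℚ (history q t) j ≡ g j) →
      (∀ s → μ (s ℕ.+ t) ≡ moves F s) →
      ∃ λ t → ∃ λ i → B ≤ startℚ (history q t) i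
    follow (reached i B≤gi) t start≡ agree = t , i , subst (_ ≤_) (sym (start≡ i)) B≤gi
    follow {g} (play m legal F) t start≡ agree = follow F (suc t) start≡′
      (λ s → trans (cong μ (ℕ.+-suc s t)) (agree (suc s)))
      where
      h = history q t
      μ≡ : μ (length h) ≡ m
      μ≡ = trans (cong μ (length-history t)) (agree 0)
      filled≡ : ∀ j → filledℚ h j ≡ (g ⊞ amount m) j
      filled≡ j = cong₂ _+_ (start≡ j) (cong (λ m → amount m j) μ≡)
      estimate≡ : ∀ j → estimateℚ h j ≡ (g ⊞ amount m) j + bonus (decoy m) j
      estimate≡ j = cong₂ _+_ (filled≡ j) (cong (λ m → bonus (decoy m) j) μ≡)
      takes-decoy : q t ≡ decoy m
      takes-decoy with q t Fin.≟ decoy m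
      ... | yes eq = eq
      -- Another selected cup, shown exactly, would have to be at least as high as the decoy plus
      -- `e`, against `legal`.
      ... | no  ne = contradiction (legal (q t) ne) (≤⇒≯ (subst₂ _≤_
            (trans (estimate≡ (decoy m)) (cong ((g ⊞ amount m) (decoy m) +_)
              (updateAt-updates (decoy m) {λ _ → e} (λ _ → 0ℚ))))
            (trans (estimate≡ (q t)) (trans (cong ((g ⊞ amount m) (q t) +_)
              (updateAt-minimal (q t) (decoy m) {λ _ → e} (λ _ → 0ℚ) ne))
              (+-identityʳ _)))
            (≤ᴿ⇒≤ {estimateᴿ h (decoy m)} {estimateᴿ h (q t)}
              (seq-estimate h (decoy m)) (seq-estimate h (q t)) (greedy t (decoy m)))))
        where
        ≤⇒≯ : ∀ {x y} → x ≤ y → ¬ (y < x)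
        ≤⇒≯ x≤y y<x = <-irrefl refl (<-≤-trans y<x x≤y)
      start≡′ : ∀ j → startℚ (q t ∷ h) j ≡ drain (decoy m) (g ⊞ amount m) j
      start≡′ j = trans (cong (λ i → drain i (filledℚ h) j) takes-decoy)
        (updateAt-natural {f = id} (λ _ → refl) filled≡ (decoy m) j)

-- The order on reals sees only tails of sequences, so it is enough that `B` is termwise at most the
-- rational target from some index on.
Forces⇒ForcesBacklog : ∀ {p c e b B} → 0ℚ ≤ e → fromℚ e ≤ᴿ c → Forces {suc p} e (λ _ → 0ℚ) b →
  (∃ λ K → ∀ k → K ℕ.≤ k → seq B k ≤ b) →
  Σ[ σ ∈ CupGame.Strategy (suc p) c ] CupGame.ForcesBacklog (suc p) c σ B
Forces⇒ForcesBacklog {p} {c} {B = B} 0≤e e≤c F (K , B≤b) =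
  strategy , greedy-play , λ q greedy ε (η , 0<η , N , η≤ε) →
    let t , i , b≤ = follow greedy F 0 (λ _ → refl) (λ s → cong (moves F) (ℕ.+-identityʳ s))
    -- The margin `η` by which `ε` exceeds `0` becomes the margin of the strict inequality
    -- `B - ε < x`.
    in start pourᴿ (history q t) i , CupGame.at-start t i , η , 0<η , K ℕ.⊔ N , λ k K⊔N≤k →
      subst (_ ≤_) (sym (seq-start (history q t) i k))
        (≤-trans (≤-trans (subst ((seq B k - seq ε k) + η ≤_)
            (solve 2 (λ B ε → (B ⊖ ε) ⊕ (con 0ℚ ⊕ ε) ⊜ B) refl (seq B k) (seq ε k))
            (+-monoʳ-≤ (seq B k - seq ε k) (subst₂ _≤_ refl (sym (+-identityˡ (seq ε k)))
              (subst (_≤ seq ε k) (+-identityˡ η) (η≤ε k (ℕ.m⊔n≤o⇒n≤o K N K⊔N≤k))))))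
          (B≤b k (ℕ.m⊔n≤o⇒m≤o K N K⊔N≤k))) b≤)
  where
  open FollowMoves {p} {c} 0≤e e≤c (moves F)
  open CupGame (suc p) c

-- Choosing the parameters

0≤-eventually : ∀ {c} → 0ℝ <ᴿ c → ∃ λ N → ∀ k → N ℕ.≤ k → 0ℚ ≤ seq c k
0≤-eventually (η , 0<η , N , h) = N , λ k N≤k →
  ≤-trans (<⇒≤ 0<η) (subst (_≤ _) (+-identityˡ η) (h k N≤k))

-- A late term `q` is within `w` of the tail of `c`, so `q - w` lies below the tail by at most `2w`.
-- The cut at `0` makes it a valid nonnegative bonus and stays below the tail because `c` is
-- positive.
rational-below : ∀ {c} → 0ℝ <ᴿ c → ∀ {w} → 0ℚ < w →
  Σ[ e ∈ ℚ ] 0ℚ ≤ e × ∃ λ K → ∀ k → K ℕ.≤ k → e ≤ seq c k × seq c k ≤ e + (w + w)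
rational-below {c} 0<c {w} 0<w = let
    N , 0≤c = 0≤-eventually {c} 0<c
    M , close = cauchy c w 0<w
    q = seq c M
  in (q - w) ⊔ 0ℚ , p≤q⊔p (q - w) 0ℚ , N ℕ.⊔ M , λ k N⊔M≤k →
    let M≤k = ℕ.m⊔n≤o⇒n≤o N M N⊔M≤k in
    ⊔-lub (subst (q - w ≤_) (solve 2 (λ x w → (x ⊕ w) ⊖ w ⊜ x) refl (seq c k) w)
            (+-monoˡ-≤ (- w) (∣p-q∣≤r⇒p≤q+r {q} {seq c k} (close M k ℕ.≤-refl M≤k))))
          (0≤c k (ℕ.m⊔n≤o⇒m≤o N M N⊔M≤k))
    , ≤-trans (∣p-q∣≤r⇒p≤q+r {seq c k} {q} (close k M M≤k ℕ.≤-refl))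
        (subst (_≤ ((q - w) ⊔ 0ℚ) + (w + w)) (solve 2 (λ q w → (q ⊖ w) ⊕ (w ⊕ w) ⊜ q ⊕ w) refl q w)
          (+-monoˡ-≤ (w + w) (p≤p⊔q (q - w) 0ℚ)))

4ℚ : ℚ
4ℚ = ℤ.+ 4 / 1

-- With u = c + 1 ≤ D + 3w and ℓ = ln n ≤ 1 + H:  u (ℓ - 4) ≤ u H - 3u ≤ D H + 3 w H - 3 ≤ D H.
backlog-bound : ∀ {u ℓ D w H} → 1ℚ ≤ u → u ≤ D + (w + w + w) → ℓ ≤ 1ℚ + H → 0ℚ ≤ H → w * H ≤ 1ℚ →
  u * ℓ - 4ℚ * u ≤ D * H
backlog-bound {u} {ℓ} {D} {w} {H} 1≤u u≤ ℓ≤ 0≤H wH≤1 = begin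
  u * ℓ - 4ℚ * u                          ≤⟨ +-monoˡ-≤ (- (4ℚ * u)) (*-monoˡ u (≤-trans (<⇒≤ (1/suc-pos 0)) 1≤u) ℓ≤) ⟩
  u * (1ℚ + H) - 4ℚ * u                   ≡⟨ solve 2 (λ u H → u ⊗ (con 1ℚ ⊕ H) ⊖ con 4ℚ ⊗ u ⊜ H ⊗ u ⊖ (u ⊕ u ⊕ u)) refl u H ⟩
  H * u - (u + u + u)                     ≤⟨ +-mono-≤ (*-monoˡ H 0≤H u≤) (neg-antimono-≤ (triple 1≤u)) ⟩
  H * (D + (w + w + w)) - (1ℚ + 1ℚ + 1ℚ)  ≡⟨ solve 4 (λ H D w t → H ⊗ (D ⊕ (w ⊕ w ⊕ w)) ⊖ t ⊜
    D ⊗ H ⊕ (w ⊗ H ⊕ w ⊗ H ⊕ w ⊗ H ⊖ t)) refl H D w (1ℚ + 1ℚ + 1ℚ) ⟩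
  D * H + (w * H + w * H + w * H - (1ℚ + 1ℚ + 1ℚ)) ≤⟨ +-monoʳ-≤ (D * H) (+-monoˡ-≤ (- (1ℚ + 1ℚ + 1ℚ)) (triple wH≤1)) ⟩
  D * H + 0ℚ                              ≡⟨ +-identityʳ (D * H) ⟩
  D * H                                   ∎
  where
  open ≤-Reasoning
  triple : ∀ {x y} → x ≤ y → x + x + x ≤ y + y + y
  triple x≤y = +-mono-≤ (+-mono-≤ x≤y x≤y) x≤y

theorem6 : Σ[ C ∈ ℝ ]
    ((c : ℝ) → 0ℝ <ᴿ c → (n : ℕ) .{{_ : NonZero n}} →
    Σ[ σ ∈ CupGame.Strategy n c ]
    CupGame.ForcesBacklog n c σ
    ((c +ᴿ 1ℝ) *ᴿ ln n -ᴿ C *ᴿ (c +ᴿ 1ℝ)))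
theorem6 = fromℚ 4ℚ , λ where
  c 0<c (suc p) →
    -- `D` gives up `w` to be strictly below `1 + e`, and `e` gives up at most `2w` against `c`,
    -- whence `c + 1 ≤ D + 3w`. With `w = 1/n` the loss `3w * harmonic p` is at most `3`.
    let w = 1/suc p
        e , 0≤e , K , near = rational-below {c} 0<c (1/suc-pos p)
        D = (1ℚ - w) + e
        B = (c +ᴿ 1ℝ) *ᴿ ln (suc p) -ᴿ fromℚ 4ℚ *ᴿ (c +ᴿ 1ℝ)
    in Forces⇒ForcesBacklog {B = B} 0≤e
      (λ ε 0<ε → K , λ k K≤k → ≤-trans (proj₁ (near k K≤k)) (p≤p+q _ (<⇒≤ 0<ε)))
      (empty-forces p {D} (+-mono-≤ (p≤q⇒0≤q-p (1/suc≤1 p)) 0≤e)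
        (+-monoˡ-< e (+-monoʳ-< 1ℚ (neg-antimono-< (1/suc-pos p)))))
      (K , λ k K≤k → let e≤c , c≤ = near k K≤k in
        backlog-bound {D = D} {w}
          (subst (_≤ seq c k + 1ℚ) (+-identityˡ 1ℚ) (+-monoˡ-≤ 1ℚ (≤-trans 0≤e e≤c)))
          (subst (seq c k + 1ℚ ≤_)
            (solve 2 (λ e w → (e ⊕ (w ⊕ w)) ⊕ con 1ℚ ⊜ ((con 1ℚ ⊖ w) ⊕ e) ⊕ (w ⊕ w ⊕ w)) refl e w)
            (+-monoˡ-≤ 1ℚ c≤))
          (lnSum≤harmonic+1 p k) (harmonic-nonneg p) (1/suc*harmonic≤1 p))
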